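{- Let $n\ge 1$ and let $I=(i_1,\ldots,i_r)$ be a composition of $n$. Let $D_I$ be the set of permutations $\sigma\in\mathfrak S_n$ whose descent set $\{j\in[1,n-1] : \sigma(j)>\sigma(j+1)\}$ equals $\{i_1,\, i_1+i_2,\,\ldots,\, i_1+\cdots+i_{r-1}\}$. Then $$\sum_{\sigma\in D_I} x_{\operatorname{Mc}(\sigma^{ -1})}=\sum_{\sigma\in D_I} x_{\operatorname{Ic}(\sigma^{ -1})}=r_I(\mathbf X_I).$$ Equivalently, the nondecreasing rearrangements of $\operatorname{Mc}(\sigma^{ -1})$ and of $\operatorname{Ic}(\sigma^{ -1})$ have the same distribution when $\sigma$ runs over $D_I$.
   Context: Permutations are written as words $\sigma=\sigma(1)\cdots\sigma(n)$. The $x_0,x_1,x_2,\ldots$ are commuting indeterminates, and for a sequence $c=(c_1,\ldots,c_n)$ of nonnegative integers, $x_c=x_{c_1}x_{c_2}\cdots x_{c_n}$. For $m\ge 0$ let $X_m=\{x_0,\ldots,x_m\}$ and let $h_k(X_m)$ be the complete homogeneous symmetric polynomial of degree $k$ in $x_0,\ldots,x_m$ (with $h_0=1$). Invcode: for $\sigma\in\mathfrak S_n$, $\operatorname{Ic}(\sigma)=(a_1,\ldots,a_n)$ where $a_i$ is the number of values greater than $i$ lying to the left of $i$ in $\sigma$. Majcode: the major index of a word $w=w_1\cdots w_m$ of integers is $\operatorname{maj}(w)=\sum_{j:\,w_j>w_{j+1}} j$. For $\sigma\in\mathfrak S_n$ let $\sigma^{(i)}$ be the subword of $\sigma$ obtained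 by erasing the letters smaller than $i$. Then $\operatorname{Mc}(\sigma)=(c_1,\ldots,c_n)$ with $c_n=0$ and $c_i=\operatorname{maj}(\sigma^{(i)})-\operatorname{maj}(\sigma^{(i+1)})$ for $1\le i\le n-1$. Flagged ribbon Schur function: writing $s_q=i_1+\cdots+i_q$, $r_I(\mathbf X_I)$ is the determinant of the $r\times r$ matrix $M$ with $M_{p,q}=h_{i_p+i_{p+1}+\cdots+i_q}(X_{n-s_q})$ for $q\ge p$, $M_{q+1,q}=1$, and $M_{p,q}=0$ for $p>q+1$. -}

module Defs where

open import Level using (Level)
open import Data.Bool using (Bool; true; false; if_then_else_; _∧_)
open import Data.Nat using (ℕ; zero; suc; _+_; _∸_; _≤_; _≡ᵇ_; _<ᵇ_; _≤ᵇ_)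
open import Data.Nat.Properties using (_≟_)
open import Data.List using (List; []; _∷_; map; concatMap; filterᵇ; length; take; upTo)
open import Data.Nat.ListAction using (sum)
open import Data.Bool.ListAction using (and)
open import Data.List.Relation.Unary.All using (All)
open import Data.List.Properties using (≡-dec)
open import Data.Fin using (Fin; zero; suc; toℕ; punchIn)
open import Relation.Nullary.Decidable using (⌊_⌋)
open import Relation.Binary.PropositionalEquality using (_≡_)
open import Algebra.Bundles using (CommutativeRing)

-- Words, permutations (as words σ(1)⋯σ(n) over {1,…,n})

range1 : ℕ → List ℕ
range1 n = map suc (upTo n)

allWords : ℕ → ℕ → List (List ℕ)
allWords n zero    = [] ∷ []
allWords n (suc k) = concatMap (λ v → map (v ∷_) (allWords n k)) (range1 n)

count : ℕ → List ℕ → ℕ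
count v w = length (filterᵇ (λ a → a ≡ᵇ v) w)

-- a word of length n over {1..n} is a permutation iff each value occurs once
isPermᵇ : ℕ → List ℕ → Bool
isPermᵇ n w = and (map (λ v → count v w ≡ᵇ 1) (range1 n))

Sym : ℕ → List (List ℕ)
Sym n = filterᵇ (isPermᵇ n) (allWords n n)

posOf : ℕ → List ℕ → ℕ
posOf i []      = 0
posOf i (a ∷ w) = if a ≡ᵇ i then 1 else suc (posOf i w)

inverse : ℕ → List ℕ → List ℕ
inverse n σ = map (λ i → posOf i σ) (range1 n)

descFrom : ℕ → List ℕ → List ℕ
descFrom j []            = []
descFrom j (a ∷ [])      = []
descFrom j (a ∷ b ∷ w) =
  if b <ᵇ a then j ∷ descFrom (suc j) (b ∷ w) else descFrom (suc j) (b ∷ w)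

descents : List ℕ → List ℕ
descents = descFrom 1

maj : List ℕ → ℕ
maj w = sum (descents w)

IsComposition : ℕ → List ℕ → Set
IsComposition n I = All (1 ≤_) I × sum I ≡ n
  where open import Data.Product using (_×_)

compDesFrom : ℕ → List ℕ → List ℕ
compDesFrom acc []            = []
compDesFrom acc (i ∷ [])      = []
compDesFrom acc (i ∷ j ∷ I)   = (acc + i) ∷ compDesFrom (acc + i) (j ∷ I)

compDes : List ℕ → List ℕ
compDes = compDesFrom 0

-- D_I : permutations of 𝔖ₙ with descent set {i₁, …, i₁+⋯+i_{r-1}}
-- (both sets are listed in increasing order, so list equality = set equality)
DI : ℕ → List ℕ → List (List ℕ)
DI n I = filterᵇ (λ σ → ⌊ ≡-dec _≟_ (descents σ) (compDes I) ⌋) (Sym n)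

before : ℕ → List ℕ → List ℕ
before i []      = []
before i (a ∷ w) = if a ≡ᵇ i then [] else a ∷ before i w

Ic : ℕ → List ℕ → List ℕ
Ic n σ = map (λ i → length (filterᵇ (λ a → i <ᵇ a) (before i σ))) (range1 n)

sub : ℕ → List ℕ → List ℕ
sub i w = filterᵇ (λ a → i ≤ᵇ a) w

-- Mc(σ) = (c₁,…,cₙ), cₙ = 0, cᵢ = maj(σ^{(i)}) − maj(σ^{(i+1)})
-- (this difference is always ≥ 0, so truncated subtraction is exact)
Mc : ℕ → List ℕ → List ℕ
Mc n σ = map (λ i → if i ≡ᵇ n then 0 else maj (sub i σ) ∸ maj (sub (suc i) σ)) (range1 n)

lookupℕ : List ℕ → ℕ → ℕ
lookupℕ []      _       = 0
lookupℕ (a ∷ _) zero    = a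
lookupℕ (_ ∷ l) (suc k) = lookupℕ l k

module WithRing {c ℓ : Level} (R : CommutativeRing c ℓ) where
  open CommutativeRing R using (Carrier; 0#; 1#; -_) renaming (_+_ to _+R_; _*_ to _*R_)

  sumR : List Carrier → Carrier
  sumR []      = 0#
  sumR (a ∷ l) = a +R sumR l

  monomial : (ℕ → Carrier) → List ℕ → Carrier
  monomial x []      = 1#
  monomial x (k ∷ c) = x k *R monomial x c

  h : ℕ → List Carrier → Carrier
  h zero    _        = 1#
  h (suc k) []       = 0#
  h (suc k) (v ∷ vs) = v *R h k (v ∷ vs) +R h (suc k) vs

  X : (ℕ → Carrier) → ℕ → List Carrier
  X x m = map x (upTo (suc m))

  sgn : ℕ → Carrier → Carrier
  sgn zero    a = a
  sgn (suc j) a = - sgn j a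

  det : (k : ℕ) → (Fin k → Fin k → Carrier) → Carrier
  det zero    M = 1#
  det (suc k) M = go (suc k) (λ j → j) 
    where
    minor : Fin (suc k) → Fin k → Fin k → Carrier
    minor j p q = M (suc p) (punchIn j q)
    go : (m : ℕ) → (Fin m → Fin (suc k)) → Carrier
    go zero    f = 0#
    go (suc m) f = sgn (toℕ (f zero)) (M zero (f zero) *R det k (minor (f zero)))
                   +R go m (λ t → f (suc t))

  psum : List ℕ → ℕ → ℕ
  psum I q = sum (take q I)

  -- the matrix entry M_{p,q} (1-indexed p,q)
  ribbonEntry : (ℕ → Carrier) → ℕ → List ℕ → ℕ → ℕ → Carrier
  ribbonEntry x n I p q =
    if p ≤ᵇ q then h (psum I q ∸ psum I (p ∸ 1)) (X x (n ∸ psum I q))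
    else (if p ≡ᵇ suc q then 1# else 0#)

  ribbon : (ℕ → Carrier) → ℕ → List ℕ → Carrier
  ribbon x n I = det (length I) (λ p q → ribbonEntry x n I (suc (toℕ p)) (suc (toℕ q)))

{-# OPTIONS --safe #-}
-- A permutation σ is determined by its Lehmer code c = Ic(σ⁻¹), with 0 ≤ cᵢ ≤ n - i:
-- σ(i) is the cᵢ-th remaining value, σ⁻¹ arises by inserting the letters n, …, 1 in
-- turn, letter i into the gap cᵢ of the word already built, and σ has a descent at i
-- iff cᵢ > cᵢ₊₁.  Both statistics therefore attach a label to each insertion: the gap
-- a itself for Ic, the increase of the major index for Mc.
--
-- In either case the labels of the gaps 0, …, a form an interval of a + 1 integers, of
-- which the label of gap a is the least or the greatest element; the interval is not
-- changed by an insertion into gap a.  The two recurrences of h, removing the first or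
-- the last variable, then show that inserting i letters into weakly decreasing gaps of
-- any word of length m contributes the factor hᵢ(Xₘ).  Hence the sum S over D_I satisfies
--   S(i, j, J) + S(i + j, J) = hᵢ(Xₘ) S(j, J),   m = j + |J|,
-- which is also the expansion of the ribbon determinant along its first column.
module Submission where

open import Defs
open import Level using (Level)
open import Data.Bool using (Bool; true; false; if_then_else_; _∧_; not)
open import Data.Bool.ListAction using (and)
import Data.Bool.Properties as Bool
open import Data.Empty using (⊥-elim)
open import Data.Fin using (Fin; zero; suc; toℕ; punchIn)
open import Data.List using (List; []; _∷_; _++_; _∷ʳ_; map; length; drop; concatMap; applyUpTo; upTo; filterᵇ)
import Data.List.Properties as List
open import Data.List.Relation.Binary.Sublist.Propositional using (_⊆_; _∷_; []; ⊆-refl; ⊆-trans) renaming (_∷ʳ_ to _skip_)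
open import Data.List.Relation.Binary.Sublist.Propositional.Properties using (All-resp-⊆)
open import Data.List.Relation.Unary.All as All using (All; []; _∷_)
import Data.List.Relation.Unary.All.Properties as All
open import Data.List.Relation.Unary.AllPairs as AllPairs using (AllPairs; []; _∷_)
import Data.List.Relation.Unary.AllPairs.Properties as AllPairs
open import Data.Nat using (ℕ; zero; suc; _+_; _∸_; _≤_; _<_; z≤n; s≤s; _≤ᵇ_; _<ᵇ_; _≡ᵇ_)
open import Data.Nat.ListAction using () renaming (sum to sumℕ)
import Data.Nat.Properties as ℕ
open import Data.Nat.Solver using (module +-*-Solver)
open import Data.Product as Product using (_×_; _,_; proj₁; proj₂; ∃₂)
open import Data.Sum as Sum using (_⊎_; inj₁; inj₂)
open import Function using (_∘_; id; mk⇔)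
open import Relation.Binary using (tri<; tri≈; tri>)
open import Relation.Binary.PropositionalEquality as ≡ using (_≡_; _≢_; refl)
open import Relation.Nullary using (Dec; yes; no; _because_)
open import Relation.Nullary.Decidable using (⌊_⌋)
open import Relation.Nullary.Reflects using (Reflects; ofʸ; ofⁿ)
open import Algebra.Bundles using (CommutativeRing)

-- Boolean order tests on natural numbers.

<ᵇ-true : ∀ {m n} → m < n → (m <ᵇ n) ≡ true
<ᵇ-true (s≤s z≤n)       = refl
<ᵇ-true (s≤s (s≤s m<n)) = <ᵇ-true (s≤s m<n)

<ᵇ-false : ∀ {m n} → n ≤ m → (m <ᵇ n) ≡ false
<ᵇ-false z≤n       = refl
<ᵇ-false (s≤s n≤m) = <ᵇ-false n≤m

≡ᵇ-refl : ∀ n → (n ≡ᵇ n) ≡ true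
≡ᵇ-refl zero    = refl
≡ᵇ-refl (suc n) = ≡ᵇ-refl n

≡ᵇ-false : ∀ {m n} → m ≢ n → (m ≡ᵇ n) ≡ false
≡ᵇ-false {zero}  {zero}  m≢n = ⊥-elim (m≢n refl)
≡ᵇ-false {zero}  {suc n} m≢n = refl
≡ᵇ-false {suc m} {zero}  m≢n = refl
≡ᵇ-false {suc m} {suc n} m≢n = ≡ᵇ-false (m≢n ∘ ≡.cong suc)

<ᵇ-false⁻ : ∀ m n → (m <ᵇ n) ≡ false → n ≤ m
<ᵇ-false⁻ m       zero    _ = z≤n
<ᵇ-false⁻ (suc m) (suc n) e = s≤s (<ᵇ-false⁻ m n e)

<ᵇ-+ : ∀ k a b → (k + a <ᵇ k + b) ≡ (a <ᵇ b)
<ᵇ-+ zero    a b = refl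
<ᵇ-+ (suc k) a b = <ᵇ-+ k a b

≡ᵇ-true⁻ : ∀ m n → (m ≡ᵇ n) ≡ true → m ≡ n
≡ᵇ-true⁻ zero    zero    _ = refl
≡ᵇ-true⁻ (suc m) (suc n) e = ≡.cong suc (≡ᵇ-true⁻ m n e)

-- Hessenberg determinants and the recurrence of the ribbon determinant.

module Determinants {c ℓ : Level} (R : CommutativeRing c ℓ) where
  open CommutativeRing R hiding (zero; refl) renaming (_+_ to _+R_; _*_ to _*R_; _-_ to _-R_)
  open CommutativeRing R using () renaming (refl to ≈-refl)
  open WithRing R
  open import Algebra.Properties.CommutativeMonoid.Sum +-commutativeMonoid using (sum; sum-cong-≋)
  open import Algebra.Properties.AbelianGroup +-abelianGroup using (ε⁻¹≈ε; ⁻¹-∙-comm)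
  open import Relation.Binary.Reasoning.Setoid setoid

  Matrix : ℕ → Set c
  Matrix k = Fin k → Fin k → Carrier

  minor : ∀ {k} → Matrix (suc k) → Fin (suc k) → Matrix k
  minor M j p q = M (suc p) (punchIn j q)

  -- The summation inside `det` is a local function that cannot be named from
  -- here.  Unification recovers it: `det-tail` is read off two unfoldings of
  -- `det`, and abstracting its size and column arguments yields `rowFrom`.
  mutual
    det-tail : ∀ k → Matrix (suc (suc k)) → Carrier
    det-tail k M = _

    det-tail-def : ∀ k M → det (suc (suc k)) M ≡ _ +R (_ +R det-tail k M)
    det-tail-def k M = refl

  mutual
    rowFrom : ∀ k → Matrix (suc k) → ∀ m → (Fin m → Fin (suc k)) → Carrier
    rowFrom k M m f = _

    rowFrom-def : ∀ k M → det-tail k M ≡ det-tail k M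
    rowFrom-def k M with suc k | M | (λ (t : Fin k) → Fin.suc (Fin.suc t))
    ... | K | M′ | f = refl {x = rowFrom K M′ k f}

  term : ∀ {k} → Matrix (suc k) → Fin (suc k) → Carrier
  term {k} M j = sgn (toℕ j) (M zero j *R det k (minor M j))

  rowFrom≡sum : ∀ k M m f → rowFrom k M m f ≡ sum (term M ∘ f)
  rowFrom≡sum k M zero    f = refl
  rowFrom≡sum k M (suc m) f = ≡.cong (term M (f zero) +R_) (rowFrom≡sum k M m (f ∘ suc))

  det-expand : ∀ k M → det (suc k) M ≡ sum (term M)
  det-expand k M = rowFrom≡sum k M (suc k) (λ j → j)

  sgn-cong : ∀ j {a b} → a ≈ b → sgn j a ≈ sgn j b
  sgn-cong zero    e = e
  sgn-cong (suc j) e = -‿cong (sgn-cong j e)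

  sgn-0 : ∀ j → sgn j 0# ≈ 0#
  sgn-0 zero    = ≈-refl
  sgn-0 (suc j) = trans (-‿cong (sgn-0 j)) ε⁻¹≈ε

  sum-0 : ∀ n {f : Fin n → Carrier} → (∀ i → f i ≈ 0#) → sum f ≈ 0#
  sum-0 zero    e = ≈-refl
  sum-0 (suc n) e = trans (+-cong (e zero) (sum-0 n (e ∘ suc))) (+-identityˡ 0#)

  sum-neg : ∀ n (f : Fin n → Carrier) → sum (λ i → - f i) ≈ - sum f
  sum-neg zero    f = sym ε⁻¹≈ε
  sum-neg (suc n) f = trans (+-congˡ (sum-neg n (f ∘ suc))) (⁻¹-∙-comm _ _)

  det-cong : ∀ k {M N : Matrix k} → (∀ p q → M p q ≈ N p q) → det k M ≈ det k N
  det-cong zero    e = ≈-refl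
  det-cong (suc k) {M} {N} e = begin
    det (suc k) M  ≡⟨ det-expand k M ⟩
    sum (term M)   ≈⟨ sum-cong-≋ (λ j → sgn-cong (toℕ j)
                        (*-cong (e zero j) (det-cong k (λ p q → e (suc p) (punchIn j q))))) ⟩
    sum (term N)   ≡⟨ det-expand k N ⟨
    det (suc k) N  ∎

  det-zeroColumn : ∀ k M → (∀ p → M p zero ≈ 0#) → det (suc k) M ≈ 0#
  det-zeroColumn k M e = begin
    det (suc k) M  ≡⟨ det-expand k M ⟩
    sum (term M)   ≈⟨ sum-0 (suc k) (λ j → trans (sgn-cong (toℕ j) (vanish k M e j)) (sgn-0 (toℕ j))) ⟩
    0#             ∎
    where
    vanish : ∀ k (M : Matrix (suc k)) → (∀ p → M p zero ≈ 0#) →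
             ∀ j → M zero j *R det k (minor M j) ≈ 0#
    vanish k       M e zero    = trans (*-congʳ (e zero)) (zeroˡ _)
    -- Deleting column `suc j` keeps column zero, so the minor falls under the induction hypothesis.
    vanish (suc k) M e (suc j) =
      trans (*-congˡ (det-zeroColumn k (minor M (suc j)) (e ∘ suc))) (zeroʳ _)

  det-cornerColumn : ∀ k M → (∀ p → M (suc p) zero ≈ 0#) →
                     det (suc k) M ≈ M zero zero *R det k (minor M zero)
  det-cornerColumn k M e = begin
    det (suc k) M                                   ≡⟨ det-expand k M ⟩
    term M zero +R sum (term M ∘ suc)               ≈⟨ +-congˡ (sum-0 k (vanish k M e)) ⟩
    M zero zero *R det k (minor M zero) +R 0#       ≈⟨ +-identityʳ _ ⟩
    M zero zero *R det k (minor M zero)             ∎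
    where
    vanish : ∀ k (M : Matrix (suc k)) → (∀ p → M (suc p) zero ≈ 0#) →
             ∀ j → term M (suc j) ≈ 0#
    vanish (suc k) M e j = trans (sgn-cong (suc (toℕ j))
      (trans (*-congˡ (det-zeroColumn k (minor M (suc j)) e)) (zeroʳ _))) (sgn-0 (suc (toℕ j)))

  -- The first column goes too: this is the minor of the subdiagonal entry in the second row.
  deleteSecondRow : ∀ {k} → Matrix (suc (suc k)) → Matrix (suc k)
  deleteSecondRow M zero    q = M zero (suc q)
  deleteSecondRow M (suc p) q = M (suc (suc p)) (suc q)

  -- `det` expands along the first row only. A minor that keeps column zero has first column 1, 0,
  -- ..., 0, so it reduces to its own corner minor, and these are the minors of `deleteSecondRow M`.
  -- The sign flips because their columns start one place later.
  det-hessenbergColumn : ∀ k M → M (suc zero) zero ≈ 1# → (∀ p → M (suc (suc p)) zero ≈ 0#) →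
    det (suc (suc k)) M ≈
      M zero zero *R det (suc k) (minor M zero) -R det (suc k) (deleteSecondRow M)
  det-hessenbergColumn k M e₁ e₀ = begin
    det (suc (suc k)) M                                ≡⟨ det-expand (suc k) M ⟩
    term M zero +R sum (term M ∘ suc)                  ≈⟨ +-congˡ (sum-cong-≋ tail) ⟩
    term M zero +R sum (λ j → - term (deleteSecondRow M) j)
                                                       ≈⟨ +-congˡ (sum-neg (suc k) (term (deleteSecondRow M))) ⟩
    term M zero -R sum (term (deleteSecondRow M))      ≡⟨ ≡.cong (term M zero -R_) (det-expand k (deleteSecondRow M)) ⟨
    term M zero -R det (suc k) (deleteSecondRow M)     ∎
    where
    tail : ∀ j → term M (suc j) ≈ - term (deleteSecondRow M) j
    tail j = -‿cong (sgn-cong (toℕ j) (*-congˡ (begin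
      det (suc k) (minor M (suc j))
        ≈⟨ det-cornerColumn k (minor M (suc j)) e₀ ⟩
      M (suc zero) zero *R det k (minor (minor M (suc j)) zero)
        ≈⟨ *-congʳ e₁ ⟩
      1# *R det k (minor (minor M (suc j)) zero)
        ≈⟨ *-identityˡ _ ⟩
      det k (minor (minor M (suc j)) zero) ∎)))

  module _ (x : ℕ → Carrier) where

    -- The first part shifts every partial sum by `i`. The shift cancels in the degree and is
    -- absorbed by `n ∸ i` in the alphabet.
    entry-tail : ∀ n i J p q →
      ribbonEntry x n (i ∷ J) (suc (suc p)) (suc (suc q)) ≡ ribbonEntry x (n ∸ i) J (suc p) (suc q)
    entry-tail n i J p q
      rewrite ℕ.[m+n]∸[m+o]≡n∸o i (psum J (suc q)) (psum J p)
            | ≡.sym (ℕ.∸-+-assoc n i (psum J (suc q))) = refl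

    entry-merge : ∀ n i j J p q →
      ribbonEntry x n (i ∷ j ∷ J) (suc (suc (suc p))) (suc (suc q)) ≡
      ribbonEntry x n (i + j ∷ J) (suc (suc p)) (suc q)
    entry-merge n i j J p q
      rewrite ℕ.+-assoc i j (psum J q) | ℕ.+-assoc i j (psum J p) = refl

    entry-merge₀ : ∀ n i j J q →
      ribbonEntry x n (i ∷ j ∷ J) 1 (suc (suc q)) ≡ ribbonEntry x n (i + j ∷ J) 1 (suc q)
    entry-merge₀ n i j J q rewrite ℕ.+-assoc i j (psum J q) = refl

    -- The first column is hᵢ, 1, 0, .... Without the second row and the first column the matrix
    -- loses just the partial sum `i`, which is the effect of merging `i` and `j`.
    ribbon-∷ : ∀ n i j J → ribbon x n (i ∷ j ∷ J) ≈
      h i (X x (n ∸ i)) *R ribbon x (n ∸ i) (j ∷ J) -R ribbon x n (i + j ∷ J)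
    ribbon-∷ n i j J = trans
      (det-hessenbergColumn (length J) M (≈-refl) (λ p → ≈-refl))
      (+-cong
        (*-cong (reflexive (≡.cong (λ s → h s (X x (n ∸ s))) (ℕ.+-identityʳ i)))
                (det-cong (suc (length J)) (λ p q → reflexive (entry-tail n i (j ∷ J) (toℕ p) (toℕ q)))))
        (-‿cong (det-cong (suc (length J)) merge)))
      where
      M : Matrix (length (i ∷ j ∷ J))
      M p q = ribbonEntry x n (i ∷ j ∷ J) (suc (toℕ p)) (suc (toℕ q))
      merge : ∀ p q → deleteSecondRow M p q ≈
              ribbonEntry x n (i + j ∷ J) (suc (toℕ p)) (suc (toℕ q))
      merge zero    q = reflexive (entry-merge₀ n i j J (toℕ q))
      merge (suc p) q = reflexive (entry-merge n i j J (toℕ p) (toℕ q))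

    ribbon-[_] : ∀ i n → ribbon x n (i ∷ []) ≈ h i (X x (n ∸ i))
    ribbon-[ i ] n = trans (+-identityʳ _) (trans (*-identityʳ _)
      (reflexive (≡.cong (λ s → h s (X x (n ∸ s))) (ℕ.+-identityʳ i))))

-- Lehmer codes, gap labellings and descent constraints.

data Code : ℕ → List ℕ → Set where
  []  : Code 0 []
  _∷_ : ∀ {m a c} → a ≤ m → Code m c → Code (suc m) (a ∷ c)

Code-length : ∀ {m c} → Code m c → length c ≡ m
Code-length []      = refl
Code-length (_ ∷ C) = ≡.cong suc (Code-length C)

-- `lo a c … lo a c + a` is the interval of labels of the gaps 0 … a, and the
-- label of gap a is one of its two ends, removed on passing to gap a - 1.
record Labelling : Set where
  field
    lab lo   : ℕ → List ℕ → ℕ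
    lab-zero : ∀ {m c} → Code m c → lab 0 c ≡ lo 0 c
    lab-suc  : ∀ {m c a} → Code m c → suc a ≤ m →
      (lab (suc a) c ≡ lo (suc a) c × lo a c ≡ suc (lo (suc a) c)) ⊎
      (lab (suc a) c ≡ lo (suc a) c + suc a × lo a c ≡ lo (suc a) c)
    lo-full  : ∀ {m c} → Code m c → lo m c ≡ 0
    lo-∷     : ∀ {m c p} → Code m c → p ≤ m → lo p (p ∷ c) ≡ lo p c

  labels : List ℕ → List ℕ
  labels []      = []
  labels (a ∷ c) = lab a c ∷ labels c

-- `any` never occurs in `constraints`; it serves to free the comparison at the end of a block,
-- where the sum then factors.
data Constraint : Set where
  asc des any : Constraint

ok : Constraint → ℕ → List ℕ → Bool
ok any a c       = true
ok _   a []      = true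
ok asc a (b ∷ c) = not (b <ᵇ a)
ok des a (b ∷ c) = b <ᵇ a

-- The last constraint has no following letter and always holds.
sat : List Constraint → List ℕ → Bool
sat []      c       = true
sat (k ∷ κ) []      = true
sat (k ∷ κ) (a ∷ c) = ok k a c ∧ sat κ c

-- Constrains `suc i` letters, so that a block is never empty; `t` compares its last letter with the
-- first letter of the next block.
block : ℕ → Constraint → List Constraint → List Constraint
block zero    t κ = t ∷ κ
block (suc i) t κ = asc ∷ block i t κ

constraints : List ℕ → List Constraint
constraints []          = []
constraints (zero ∷ I)  = constraints I
constraints (suc i ∷ I) = block i des (constraints I)

-- An ascent at the boundary fuses blocks of `suc i` and `suc j` letters, which merges two parts of
-- the composition.
block-asc : ∀ i j t κ → block i asc (block j t κ) ≡ block (i + suc j) t κ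
block-asc zero    j t κ = refl
block-asc (suc i) j t κ = ≡.cong (asc ∷_) (block-asc i j t κ)

sat-final : ∀ i {c} → Code (suc i + 0) c → sat (block i des []) c ≡ sat (block i any []) c
sat-final zero    (_ ∷ []) = refl
sat-final (suc i) {a ∷ c} (_ ∷ C) = ≡.cong (ok asc a c ∧_) (sat-final i C)

-- Weighted sums over codes, evaluated block by block.

module Summation {c ℓ : Level} (R : CommutativeRing c ℓ) where
  open CommutativeRing R hiding (zero; refl) renaming (_+_ to _+R_; _*_ to _*R_; _-_ to _-R_)
  open CommutativeRing R using () renaming (refl to ≈-refl)
  open WithRing R
  open import Relation.Binary.Reasoning.Setoid setoid
  open import Algebra.Properties.CommutativeSemigroup +-commutativeSemigroup using () renaming (interchange to +-interchange)
  open import Algebra.Solver.Ring.NaturalCoefficients.Default commutativeSemiring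

  sumTo : ℕ → (ℕ → Carrier) → Carrier
  sumTo zero    g = 0#
  sumTo (suc n) g = sumTo n g +R g n

  sumTo-cong : ∀ n {f g} → (∀ a → a < n → f a ≈ g a) → sumTo n f ≈ sumTo n g
  sumTo-cong zero    e = ≈-refl
  sumTo-cong (suc n) e =
    +-cong (sumTo-cong n (λ a a<n → e a (ℕ.m<n⇒m<1+n a<n))) (e n (ℕ.n<1+n n))

  sumTo-*ˡ : ∀ n s g → sumTo n (λ a → s *R g a) ≈ s *R sumTo n g
  sumTo-*ˡ zero    s g = sym (zeroʳ s)
  sumTo-*ˡ (suc n) s g = trans (+-congʳ (sumTo-*ˡ n s g)) (sym (distribˡ s _ _))

  sumTo-restrict : ∀ {n p} → p < n → ∀ g →
    sumTo n (λ a → if not (p <ᵇ a) then g a else 0#) ≈ sumTo (suc p) g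
  sumTo-restrict {n} {p} p<n g =
    -- With the range written as `d + suc p`, induction on `d` removes the top terms, all beyond
    -- `p`.
    ≡.subst (λ n → sumTo n _ ≈ _) (ℕ.m∸n+n≡m p<n) (go (n ∸ suc p))
    where
    go : ∀ d → sumTo (d + suc p) (λ a → if not (p <ᵇ a) then g a else 0#) ≈ sumTo (suc p) g
    go zero    = sumTo-cong (suc p) (λ { a (s≤s a≤p) →
      reflexive (≡.cong (λ b → if not b then g a else 0#) (<ᵇ-false a≤p)) })
    go (suc d) = trans (+-cong (go d)
      (reflexive (≡.cong (λ b → if not b then g (d + suc p) else 0#) (<ᵇ-true (ℕ.m≤n+m (suc p) d)))))
      (+-identityʳ _)

  -- The head is summed innermost: its range and its label depend only on the tail, which is fixed
  -- at that point.
  sumCodes : ℕ → (List ℕ → Carrier) → Carrier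
  sumCodes zero    f = f []
  sumCodes (suc m) f = sumCodes m (λ c → sumTo (suc m) (λ a → f (a ∷ c)))

  sumCodes-cong : ∀ m {f g} → (∀ c → Code m c → f c ≈ g c) → sumCodes m f ≈ sumCodes m g
  sumCodes-cong zero    e = e [] []
  sumCodes-cong (suc m) e = sumCodes-cong m (λ c C →
    sumTo-cong (suc m) (λ { a (s≤s a≤m) → e (a ∷ c) (a≤m ∷ C) }))

  sumTo-+ : ∀ n f g → sumTo n (λ a → f a +R g a) ≈ sumTo n f +R sumTo n g
  sumTo-+ zero    f g = sym (+-identityˡ 0#)
  sumTo-+ (suc n) f g = trans (+-congʳ (sumTo-+ n f g)) (+-interchange _ _ _ _)

  sumCodes-+ : ∀ m f g → sumCodes m (λ c → f c +R g c) ≈ sumCodes m f +R sumCodes m g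
  sumCodes-+ zero    f g = ≈-refl
  sumCodes-+ (suc m) f g = trans
    (sumCodes-cong m (λ c _ → sumTo-+ (suc m) (f ∘ (_∷ c)) (g ∘ (_∷ c))))
    (sumCodes-+ m _ _)

  sumCodes-*ʳ : ∀ m f s → sumCodes m (λ c → f c *R s) ≈ s *R sumCodes m f
  sumCodes-*ʳ zero    f s = *-comm _ s
  sumCodes-*ʳ (suc m) f s = trans
    (sumCodes-cong m (λ c _ → begin
      sumTo (suc m) (λ a → f (a ∷ c) *R s)  ≈⟨ sumTo-cong (suc m) (λ a _ → *-comm _ s) ⟩
      sumTo (suc m) (λ a → s *R f (a ∷ c))  ≈⟨ sumTo-*ˡ (suc m) s _ ⟩
      s *R sumTo (suc m) (λ a → f (a ∷ c))  ≈⟨ *-comm s _ ⟩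
      sumTo (suc m) (λ a → f (a ∷ c)) *R s  ∎))
    (sumCodes-*ʳ m _ s)

  -- `h` is defined by removing the first variable. Induction on the list carries the recurrence
  -- over to the last one, so that an interval can be shortened at either end.
  h-∷ʳ : ∀ k vs v → h (suc k) (vs ∷ʳ v) ≈ v *R h k (vs ∷ʳ v) +R h (suc k) vs
  h-∷ʳ k       []       v = ≈-refl
  h-∷ʳ zero    (u ∷ vs) v = trans (+-congˡ (h-∷ʳ zero vs v))
    (solve 3 (λ u v w → u :* con 1 :+ (v :* con 1 :+ w) := v :* con 1 :+ (u :* con 1 :+ w))
      ≈-refl u v (h 1 vs))
  h-∷ʳ (suc k) (u ∷ vs) v = trans
    (+-cong (*-congˡ (h-∷ʳ k (u ∷ vs) v)) (h-∷ʳ (suc k) vs v))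
    (solve 6 (λ u v w₁ w₂ w₃ w₄ →
        u :* (v :* w₁ :+ w₂) :+ (v :* w₃ :+ w₄) := v :* (u :* w₁ :+ w₃) :+ (u :* w₂ :+ w₄))
      ≈-refl u v (h k (u ∷ vs ∷ʳ v)) (h (suc k) (u ∷ vs)) (h (suc k) (vs ∷ʳ v)) (h (suc (suc k)) vs))

  ite-∧ : ∀ b s y w q → (if b ∧ s then y *R w else 0#) *R q ≈
          (if s then w else 0#) *R (if b then y *R q else 0#)
  ite-∧ true  true  y w q = solve 3 (λ y w q → y :* w :* q := w :* (y :* q)) ≈-refl y w q
  ite-∧ true  false y w q = trans (zeroˡ q) (sym (zeroˡ _))
  ite-∧ false true  y w q = trans (zeroˡ q) (sym (zeroʳ w))
  ite-∧ false false y w q = trans (zeroˡ q) (sym (zeroʳ _))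

  module _ (x : ℕ → Carrier) where

    -- There are p + 1 variables, one for each of the gaps 0, ..., p.
    interval : ℕ → ℕ → List Carrier
    interval e zero    = x e ∷ []
    interval e (suc p) = x e ∷ interval (suc e) p

    interval-∷ʳ : ∀ e p → interval e (suc p) ≡ interval e p ∷ʳ x (e + suc p)
    interval-∷ʳ e zero    = ≡.cong (λ t → x e ∷ x t ∷ []) (≡.sym (ℕ.+-comm e 1))
    interval-∷ʳ e (suc p) = ≡.cong (x e ∷_) (≡.trans (interval-∷ʳ (suc e) p)
      (≡.cong (λ t → interval (suc e) p ∷ʳ x t) (≡.sym (ℕ.+-suc e (suc p)))))

    map-applyUpTo-interval : ∀ (f : ℕ → ℕ) e m → (∀ t → f t ≡ e + t) →
                             map x (applyUpTo f (suc m)) ≡ interval e m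
    map-applyUpTo-interval f e zero    eq =
      ≡.cong (λ t → x t ∷ []) (≡.trans (eq 0) (ℕ.+-identityʳ e))
    map-applyUpTo-interval f e (suc m) eq = ≡.cong₂ (λ t → x t ∷_)
      (≡.trans (eq 0) (ℕ.+-identityʳ e))
      (map-applyUpTo-interval (f ∘ suc) (suc e) m (λ t → ≡.trans (eq (suc t)) (ℕ.+-suc e t)))

    X≡interval : ∀ m → X x m ≡ interval 0 m
    X≡interval m = map-applyUpTo-interval (λ t → t) 0 m (λ _ → refl)

    -- The label `l` is the lower or the upper end of the longer interval, and `e′` is where the
    -- rest starts. The cases are the recurrences of `h` for the first and for the last variable.
    h-interval : ∀ j p {e l e′} →
      (l ≡ e × e′ ≡ suc e) ⊎ (l ≡ e + suc p × e′ ≡ e) →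
      h (suc j) (interval e′ p) +R x l *R h j (interval e (suc p)) ≈ h (suc j) (interval e (suc p))
    h-interval j p     (inj₁ (refl , refl)) = +-comm _ _
    h-interval j p {e} (inj₂ (refl , refl)) = ≡.subst
      (λ l → h (suc j) (interval e p) +R x (e + suc p) *R h j l ≈ h (suc j) l)
      (≡.sym (interval-∷ʳ e p))
      (trans (+-comm _ _) (sym (h-∷ʳ j (interval e p) _)))

    module _ (Λ : Labelling) where
      open Labelling Λ

      weight : List ℕ → Carrier
      weight c = monomial x (labels c)

      -- The sum telescopes: passing from `p` to `suc p` adjoins the label of the new gap to the
      -- interval, and the new summand is the matching term of the recurrence of `h`.
      gapSum : ∀ j {m c} → Code m c → ∀ p → p ≤ m →
        sumTo (suc p) (λ a → x (lab a c) *R h j (interval (lo a c) a)) ≈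
        h (suc j) (interval (lo p c) p)
      gapSum j {m} {c} C zero    p≤m = trans (+-identityˡ _) (trans
        (*-congʳ (reflexive (≡.cong x (lab-zero C)))) (sym (+-identityʳ _)))
      gapSum j {m} {c} C (suc p) p<m =
        trans (+-congʳ (gapSum j C p (ℕ.<⇒≤ p<m))) (h-interval j p (lab-suc C p<m))

      weightIf : List Constraint → List ℕ → Carrier
      weightIf κ c = if sat κ c then weight c else 0#

      satSum : ℕ → List Constraint → Carrier
      satSum m κ = sumCodes m (weightIf κ)

      -- Sum of the weights of all ways to prepend j further weakly increasing letters.
      prefixSum : ℕ → List ℕ → Carrier
      prefixSum j []      = h j []
      prefixSum j (p ∷ c) = h j (interval (lo p c) p)

      cons-factor : ∀ j k κ c n →
        sumTo n (λ a → weightIf (k ∷ κ) (a ∷ c) *R prefixSum j (a ∷ c)) ≈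
        weightIf κ c *R
          sumTo n (λ a → if ok k a c then x (lab a c) *R prefixSum j (a ∷ c) else 0#)
      cons-factor j k κ c n = trans
        (sumTo-cong n (λ a _ → ite-∧ (ok k a c) (sat κ c) _ _ _))
        (sumTo-*ˡ n _ _)

      -- The factor `prefixSum j` makes the induction go through: summing out the head of the block
      -- turns it into `prefixSum (suc j)` on a shorter block. The last letter of the block runs
      -- over all gaps 0, ..., m, whose labels start at 0 by `lo-full`; this gives the alphabet Xₘ.
      blockSum : ∀ i j m κ →
        sumCodes (suc i + m) (λ c → weightIf (block i any κ) c *R prefixSum j c) ≈
        h (suc i + j) (X x m) *R satSum m κ
      blockSum zero    j m κ = trans
        (sumCodes-cong m (λ c C → begin
          sumTo (suc m) (λ a → weightIf (any ∷ κ) (a ∷ c) *R prefixSum j (a ∷ c))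
            ≈⟨ cons-factor j any κ c (suc m) ⟩
          weightIf κ c *R sumTo (suc m) (λ a → x (lab a c) *R prefixSum j (a ∷ c))
            ≈⟨ *-congˡ (gapSum j C m ℕ.≤-refl) ⟩
          weightIf κ c *R h (suc j) (interval (lo m c) m)
            ≡⟨ ≡.cong (λ e → weightIf κ c *R h (suc j) (interval e m)) (lo-full C) ⟩
          weightIf κ c *R h (suc j) (interval 0 m)
            ≡⟨ ≡.cong (λ l → weightIf κ c *R h (suc j) l) (X≡interval m) ⟨
          weightIf κ c *R h (suc j) (X x m) ∎))
        (sumCodes-*ʳ m _ _)
      blockSum (suc i) j m κ = trans
        (sumCodes-cong (suc i + m) step)
        (trans (blockSum i (suc j) m κ)
          (reflexive (≡.cong (λ d → h (suc d) (X x m) *R satSum m κ) (ℕ.+-suc i j))))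
        where
        step : ∀ c → Code (suc i + m) c →
          sumTo (suc (suc i + m)) (λ a → weightIf (asc ∷ block i any κ) (a ∷ c) *R prefixSum j (a ∷ c))
          ≈ weightIf (block i any κ) c *R prefixSum (suc j) c
        step (p ∷ c) C@(p≤ ∷ C′) = begin
          sumTo n (λ a → weightIf (asc ∷ block i any κ) (a ∷ p ∷ c) *R prefixSum j (a ∷ p ∷ c))
            ≈⟨ cons-factor j asc (block i any κ) (p ∷ c) n ⟩
          w *R sumTo n (λ a → if not (p <ᵇ a) then x (lab a (p ∷ c)) *R prefixSum j (a ∷ p ∷ c) else 0#)
            ≈⟨ *-congˡ (sumTo-restrict (s≤s (ℕ.m≤n⇒m≤1+n p≤)) _) ⟩
          w *R sumTo (suc p) (λ a → x (lab a (p ∷ c)) *R prefixSum j (a ∷ p ∷ c))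
            ≈⟨ *-congˡ (gapSum j C p (ℕ.m≤n⇒m≤1+n p≤)) ⟩
          w *R h (suc j) (interval (lo p (p ∷ c)) p)
            -- The gaps up to `p` keep their interval after the insertion into gap `p`, so the
            -- result depends on `c` as `prefixSum` prescribes.
            ≡⟨ ≡.cong (λ e → w *R h (suc j) (interval e p)) (lo-∷ C′ p≤) ⟩
          w *R prefixSum (suc j) (p ∷ c) ∎
          where
          n = suc (suc i + m)
          w = weightIf (block i any κ) (p ∷ c)

      satSum-any : ∀ i m κ →
        satSum (suc i + m) (block i any κ) ≈ h (suc i) (X x m) *R satSum m κ
      satSum-any i m κ = begin
        satSum (suc i + m) (block i any κ)
          ≈⟨ sumCodes-cong (suc i + m) unit ⟩
        sumCodes (suc i + m) (λ c → weightIf (block i any κ) c *R prefixSum 0 c)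
          ≈⟨ blockSum i 0 m κ ⟩
        h (suc i + 0) (X x m) *R satSum m κ
          ≡⟨ ≡.cong (λ d → h (suc d) (X x m) *R satSum m κ) (ℕ.+-identityʳ i) ⟩
        h (suc i) (X x m) *R satSum m κ ∎
        where
        unit : ∀ c → Code (suc i + m) c →
          weightIf (block i any κ) c ≈ weightIf (block i any κ) c *R prefixSum 0 c
        unit (p ∷ c) _ = sym (*-identityʳ _)

      -- The length `suc i + suc m` guarantees a letter after the block, so its boundary is either
      -- an ascent or a descent.
      ite-split : ∀ i m κ w {c} → Code (suc i + suc m) c →
        (if sat (block i any κ) c then w else 0#) ≈
        (if sat (block i asc κ) c then w else 0#) +R (if sat (block i des κ) c then w else 0#)
      ite-split zero m κ w {a ∷ b ∷ c} (_ ∷ _ ∷ _) with b <ᵇ a | sat κ (b ∷ c)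
      ... | true  | true  = sym (+-identityˡ w)
      ... | true  | false = sym (+-identityˡ 0#)
      ... | false | true  = sym (+-identityʳ w)
      ... | false | false = sym (+-identityˡ 0#)
      ite-split (suc i) m κ w {a ∷ c} (_ ∷ C) with ok asc a c
      ... | true  = ite-split i m κ w C
      ... | false = sym (+-identityˡ 0#)

      satSum-split : ∀ i m κ → satSum (suc i + suc m) (block i any κ) ≈
        satSum (suc i + suc m) (block i asc κ) +R satSum (suc i + suc m) (block i des κ)
      satSum-split i m κ = trans
        (sumCodes-cong (suc i + suc m) (λ c C → ite-split i m κ (weight c) C))
        (sumCodes-+ (suc i + suc m) (weightIf (block i asc κ)) (weightIf (block i des κ)))

      open Determinants R using (ribbon-∷; ribbon-[_])

      -- Induction on the list of further parts, for every first part at once. Freeing the first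
      -- boundary gives a product; the surplus `s`, with an ascent there, is the sum for the merged
      -- composition. Both recursive calls are at `J`, and `ribbon-∷` has the same shape.
      satSum≈ribbon : ∀ i I → All (1 ≤_) I →
        satSum (suc i + sumℕ I) (constraints (suc i ∷ I)) ≈ ribbon x (suc i + sumℕ I) (suc i ∷ I)
      satSum≈ribbon i [] [] = begin
        satSum (suc i + 0) (block i des [])
          ≈⟨ sumCodes-cong (suc i + 0) (λ c C →
               reflexive (≡.cong (if_then weight c else 0#) (sat-final i C))) ⟩
        satSum (suc i + 0) (block i any [])
          ≈⟨ satSum-any i 0 [] ⟩
        h (suc i) (X x 0) *R 1#
          ≈⟨ *-identityʳ _ ⟩
        h (suc i) (X x 0)
          ≡⟨ ≡.cong (λ d → h (suc i) (X x d)) (ℕ.m+n∸m≡n (suc i) 0) ⟨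
        h (suc i) (X x (suc i + 0 ∸ suc i))
          ≈⟨ ribbon-[_] x (suc i) (suc i + 0) ⟨
        ribbon x (suc i + 0) (suc i ∷ []) ∎
      satSum≈ribbon i (suc j ∷ J) (_ ∷ J≥1) = begin
        satSum n κ
          ≈⟨ trans (+-congˡ (-‿inverseʳ s)) (+-identityʳ _) ⟨
        satSum n κ +R (s -R s)
          ≈⟨ trans (+-congʳ (+-comm s _)) (+-assoc _ s (- s)) ⟨
        (s +R satSum n κ) -R s
          ≈⟨ +-congʳ (satSum-split i (j + sumℕ J) _) ⟨
        satSum n (block i any (constraints (suc j ∷ J))) -R s
          ≈⟨ +-cong (satSum-any i m _) (-‿cong merged) ⟩
        h (suc i) (X x m) *R satSum m (constraints (suc j ∷ J)) -R ribbon x n (suc i + suc j ∷ J)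
          ≈⟨ +-congʳ (*-congˡ (satSum≈ribbon j J J≥1)) ⟩
        h (suc i) (X x m) *R ribbon x m (suc j ∷ J) -R ribbon x n (suc i + suc j ∷ J)
          ≡⟨ ≡.cong (λ m → h (suc i) (X x m) *R ribbon x m (suc j ∷ J) -R ribbon x n (suc i + suc j ∷ J))
               (ℕ.m+n∸m≡n (suc i) m) ⟨
        h (suc i) (X x (n ∸ suc i)) *R ribbon x (n ∸ suc i) (suc j ∷ J) -R ribbon x n (suc i + suc j ∷ J)
          ≈⟨ ribbon-∷ x n (suc i) (suc j) J ⟨
        ribbon x n (suc i ∷ suc j ∷ J) ∎
        where
        m = suc j + sumℕ J
        n = suc i + m
        κ = constraints (suc i ∷ suc j ∷ J)
        s = satSum n (block i asc (constraints (suc j ∷ J)))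
        merged : s ≈ ribbon x n (suc i + suc j ∷ J)
        merged = ≡.subst₂ (λ n κ → satSum n κ ≈ ribbon x n (suc i + suc j ∷ J))
          (ℕ.+-assoc (suc i) (suc j) (sumℕ J)) (≡.sym (block-asc i j des (constraints J)))
          (satSum≈ribbon (i + suc j) J J≥1)

-- Descents and major index under insertion of a least letter.

desCount : List ℕ → ℕ
desCount []          = 0
desCount (a ∷ [])    = 0
desCount (a ∷ b ∷ w) = if b <ᵇ a then suc (desCount (b ∷ w)) else desCount (b ∷ w)

majFrom : ℕ → List ℕ → ℕ
majFrom j w = sumℕ (descFrom j w)

-- Each descent contributes one more when positions start one later.
majFrom-suc : ∀ j w → majFrom (suc j) w ≡ desCount w + majFrom j w
majFrom-suc j []          = refl
majFrom-suc j (a ∷ [])    = refl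
majFrom-suc j (a ∷ b ∷ w) with b <ᵇ a | majFrom-suc (suc j) (b ∷ w)
... | true  | e = ≡.trans (≡.cong (suc j +_) e)
  (solve 3 (λ j d s → con 1 :+ j :+ (d :+ s) := con 1 :+ d :+ (j :+ s)) refl
    j (desCount (b ∷ w)) (majFrom (suc j) (b ∷ w)))
  where open +-*-Solver
... | false | e = e

descFrom-shift : ∀ k j w → descFrom j (map (k +_) w) ≡ descFrom j w
descFrom-shift k j []          = refl
descFrom-shift k j (a ∷ [])    = refl
descFrom-shift k j (a ∷ b ∷ w)
  rewrite descFrom-shift k (suc j) (b ∷ w) | <ᵇ-+ k b a = refl

maj-shift : ∀ k w → maj (map (k +_) w) ≡ maj w
maj-shift k w = ≡.cong sumℕ (descFrom-shift k 1 w)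

maj-map-suc : ∀ w → maj (map suc w) ≡ maj w
maj-map-suc = maj-shift 1

desCount-map-suc : ∀ w → desCount (map suc w) ≡ desCount w
desCount-map-suc []          = refl
desCount-map-suc (a ∷ [])    = refl
desCount-map-suc (a ∷ b ∷ w) rewrite desCount-map-suc (b ∷ w) = refl

desCount-∷-min : ∀ {v z} → All (v <_) z → desCount (v ∷ z) ≡ desCount z
desCount-∷-min []                                     = refl
desCount-∷-min (v<y ∷ _) rewrite <ᵇ-false (ℕ.<⇒≤ v<y) = refl

majFrom-∷-min : ∀ j {v z} → All (v <_) z → majFrom j (v ∷ z) ≡ majFrom (suc j) z
majFrom-∷-min j []                                     = refl
majFrom-∷-min j (v<y ∷ _) rewrite <ᵇ-false (ℕ.<⇒≤ v<y) = refl

ins : ℕ → ℕ → List ℕ → List ℕ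
ins zero    v w       = v ∷ w
ins (suc a) v []      = v ∷ []
ins (suc a) v (y ∷ w) = y ∷ ins a v w

length-ins : ∀ a v w → length (ins a v w) ≡ suc (length w)
length-ins zero    v w       = refl
length-ins (suc a) v []      = refl
length-ins (suc a) v (y ∷ w) = ≡.cong suc (length-ins a v w)

All-ins : ∀ {P : ℕ → Set} a {v w} → P v → All P w → All P (ins a v w)
All-ins zero    p ps       = p ∷ ps
All-ins (suc a) p []       = p ∷ []
All-ins (suc a) p (q ∷ ps) = q ∷ All-ins a p ps

drop-ins : ∀ p v {z} → p ≤ length z → drop p (ins p v z) ≡ v ∷ drop p z
drop-ins zero    v         _        = refl
drop-ins (suc p) v {y ∷ z} (s≤s p≤) = drop-ins p v p≤

majFrom-ins-zero : ∀ j {v z} → All (v <_) z → majFrom j (ins 0 v z) ≡ desCount z + majFrom j z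
majFrom-ins-zero j {v} {z} v< = ≡.trans (majFrom-∷-min j v<) (majFrom-suc j z)

-- Whether the gap suc a of z is a descent of z decides between the two cases.
majFrom-ins-suc : ∀ j a {v} z → All (v <_) z → suc a ≤ length z →
  let d = desCount (drop (suc a) z) in
  (majFrom j (ins (suc a) v z) ≡ d + majFrom j z × desCount (drop a z) ≡ suc d) ⊎
  (majFrom j (ins (suc a) v z) ≡ d + (j + a) + majFrom j z × desCount (drop a z) ≡ d)
majFrom-ins-suc j zero (y ∷ []) (v<y ∷ []) _ rewrite <ᵇ-true v<y = inj₂ (≡.sym (ℕ.+-identityʳ _) , refl)
majFrom-ins-suc j zero (y ∷ y′ ∷ z) (v<y ∷ v<y′ ∷ v<z) _
  rewrite <ᵇ-true v<y | <ᵇ-false (ℕ.<⇒≤ v<y′) | majFrom-suc (suc j) (y′ ∷ z)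
  with y′ <ᵇ y
... | true  = inj₁ (solve 3 (λ j d s → j :+ (d :+ s) := d :+ (j :+ s)) refl
                      j (desCount (y′ ∷ z)) (majFrom (suc j) (y′ ∷ z)) , refl)
  where open +-*-Solver
... | false = inj₂ (solve 3 (λ j d s → j :+ (d :+ s) := d :+ (j :+ con 0) :+ s) refl
                      j (desCount (y′ ∷ z)) (majFrom (suc j) (y′ ∷ z)) , refl)
  where open +-*-Solver
majFrom-ins-suc j (suc a) (y ∷ []) _ (s≤s ())
majFrom-ins-suc j (suc a) {v} (y ∷ y′ ∷ z) (_ ∷ v<) (s≤s a<)
  with y′ <ᵇ y | majFrom-ins-suc (suc j) a (y′ ∷ z) v< a<
... | true  | inj₁ (e , e′) = inj₁ (≡.trans (≡.cong (j +_) e)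
  (solve 3 (λ j d s → j :+ (d :+ s) := d :+ (j :+ s)) refl j (desCount (drop a z)) _) , e′)
  where open +-*-Solver
... | true  | inj₂ (e , e′) = inj₂ (≡.trans (≡.cong (j +_) e)
  (solve 4 (λ j d s a → j :+ (d :+ (con 1 :+ j :+ a) :+ s) := d :+ (j :+ (con 1 :+ a)) :+ (j :+ s)) refl
    j (desCount (drop a z)) _ a) , e′)
  where open +-*-Solver
... | false | inj₁ (e , e′) = inj₁ (e , e′)
... | false | inj₂ (e , e′) = inj₂ (≡.trans e
  (≡.cong (λ t → desCount (drop a z) + t + majFrom (suc j) (y′ ∷ z)) (≡.sym (ℕ.+-suc j a))) , e′)

-- Inverse words of codes and the two labellings.

-- The inverse permutation of the one with Lehmer code c.
inverseWord : List ℕ → List ℕ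
inverseWord []      = []
inverseWord (a ∷ c) = ins a 1 (map suc (inverseWord c))

length-inverseWord : ∀ {m c} → Code m c → length (inverseWord c) ≡ m
length-inverseWord []                = refl
length-inverseWord {c = a ∷ c} (_ ∷ C) = ≡.trans (length-ins a 1 _)
  (≡.cong suc (≡.trans (List.length-map suc (inverseWord c)) (length-inverseWord C)))

inverseWord-positive : ∀ c → All (1 ≤_) (inverseWord c)
inverseWord-positive []      = []
inverseWord-positive (a ∷ c) =
  All-ins a (s≤s z≤n) (All.map⁺ (All.universal (λ _ → s≤s z≤n) (inverseWord c)))

shifted>1 : ∀ c → All (1 <_) (map suc (inverseWord c))
shifted>1 c = All.map⁺ (All.map s≤s (inverseWord-positive c))

length-shifted : ∀ {m c} → Code m c → length (map ℕ.suc (inverseWord c)) ≡ m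
length-shifted {c = c} C = ≡.trans (List.length-map suc (inverseWord c)) (length-inverseWord C)

desCount-drop-shifted : ∀ p c → desCount (drop p (map suc (inverseWord c))) ≡ desCount (drop p (inverseWord c))
desCount-drop-shifted p c =
  ≡.trans (≡.cong desCount (List.drop-map p (inverseWord c))) (desCount-map-suc (drop p (inverseWord c)))

invLabelling : Labelling
invLabelling = record
  { lab = λ a c → a
  ; lo = λ a c → 0
  ; lab-zero = λ _ → refl
  ; lab-suc = λ _ _ → inj₂ (refl , refl)
  ; lo-full = λ _ → refl
  ; lo-∷ = λ _ _ → refl
  }

-- `majLo a c` counts the descents beyond gap `a`: an insertion there moves each of them one place
-- to the right.
majLab majLo : ℕ → List ℕ → ℕ
majLab a c = maj (inverseWord (a ∷ c)) ∸ maj (inverseWord c)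
majLo  a c = desCount (drop a (inverseWord c))

majLab-zero : ∀ c → majLab 0 c ≡ majLo 0 c
majLab-zero c with majFrom-ins-zero 1 (shifted>1 c)
... | e rewrite desCount-map-suc (inverseWord c) | maj-map-suc (inverseWord c) =
  ≡.trans (≡.cong (_∸ maj (inverseWord c)) e) (ℕ.m+n∸n≡m _ (maj (inverseWord c)))

-- The letter 1 in gap `suc a` makes position `suc a` a descent. If it was one already, `maj` grows
-- only by the moved descents, giving the lower end; otherwise it gains `suc a` as well, giving the
-- upper end.
majLab-suc : ∀ {m c a} → Code m c → suc a ≤ m →
  (majLab (suc a) c ≡ majLo (suc a) c × majLo a c ≡ suc (majLo (suc a) c)) ⊎
  (majLab (suc a) c ≡ majLo (suc a) c + suc a × majLo a c ≡ majLo (suc a) c)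
majLab-suc {c = c} {a} C a<m
  with majFrom-ins-suc 1 a _ (shifted>1 c) (≡.subst (suc a ≤_) (≡.sym (length-shifted C)) a<m)
... | r rewrite desCount-drop-shifted a c | desCount-drop-shifted (suc a) c
              | maj-map-suc (inverseWord c) =
  Sum.map (Product.map₁ cancel) (Product.map₁ cancel) r
  where
  cancel : ∀ {s t} → s ≡ t + maj (inverseWord c) → s ∸ maj (inverseWord c) ≡ t
  cancel {t = t} refl = ℕ.m+n∸n≡m t (maj (inverseWord c))

majLabelling : Labelling
majLabelling = record
  { lab = majLab
  ; lo = majLo
  ; lab-zero = λ {_} {c} _ → majLab-zero c
  ; lab-suc = majLab-suc
  ; lo-full = λ {m} {c} C →
      ≡.cong desCount (List.drop-all m (inverseWord c) (ℕ.≤-reflexive (length-inverseWord C)))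
  -- After `drop p` the inserted 1 comes first; being least, it adds no descent.
  ; lo-∷ = λ {m} {c} {p} C p≤m → ≡.trans
      (≡.cong desCount (drop-ins p 1 (≡.subst (p ≤_) (≡.sym (length-shifted C)) p≤m)))
      (≡.trans (desCount-∷-min (All.drop⁺ p (shifted>1 c))) (desCount-drop-shifted p c))
  }

-- Descent sets compared with compositions.

descFrom-head : ∀ j w {k l} → descFrom j w ≡ k ∷ l → j ≤ k
descFrom-head j []          ()
descFrom-head j (a ∷ [])    ()
descFrom-head j (a ∷ b ∷ w) e with b <ᵇ a | descFrom-head (suc j) (b ∷ w) | e
... | true  | _    | refl = ℕ.≤-refl
... | false | rest | e′   = ℕ.<⇒≤ (rest e′)

compDesFrom-suc : ∀ acc i I → compDesFrom acc (suc i ∷ I) ≡ compDesFrom (suc acc) (i ∷ I)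
compDesFrom-suc acc i []      = refl
compDesFrom-suc acc i (j ∷ I) rewrite ℕ.+-suc acc i = refl

compDesFrom-head : ∀ acc i I {l} → compDesFrom acc (suc i ∷ I) ≢ acc ∷ l
compDesFrom-head acc i []      ()
compDesFrom-head acc i (j ∷ I) e = ℕ.m+1+n≢m acc (List.∷-injectiveˡ e)

-- The word and the composition are read in parallel: `acc` letters have been read and `suc i`
-- remain in the current part. A wrong comparison shows in the first element of the two lists, since
-- later descents have larger positions.
sat-reflects : ∀ acc i I w → All (1 ≤_) I → length w ≡ suc i + sumℕ I →
  Reflects (descFrom (suc acc) w ≡ compDesFrom acc (suc i ∷ I)) (sat (constraints (suc i ∷ I)) w)
sat-reflects acc zero []      (a ∷ [])    _ _ = ofʸ refl
sat-reflects acc zero (suc j ∷ I) (a ∷ b ∷ w) (_ ∷ I≥1) e with b <ᵇ a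
... | false = ofⁿ (λ eq → ℕ.n≮n (suc acc)
  (≡.subst (suc (suc acc) ≤_) (ℕ.+-comm acc 1) (descFrom-head (suc (suc acc)) (b ∷ w) eq)))
... | true rewrite ℕ.+-comm acc 1
  with sat (constraints (suc j ∷ I)) (b ∷ w)
     | sat-reflects (suc acc) j I (b ∷ w) I≥1 (ℕ.suc-injective e)
...   | true  | ofʸ eq  = ofʸ (≡.cong (suc acc ∷_) eq)
...   | false | ofⁿ neq = ofⁿ (neq ∘ List.∷-injectiveʳ)
sat-reflects acc (suc i) I (a ∷ b ∷ w) I≥1 e
  rewrite compDesFrom-suc acc (suc i) I with b <ᵇ a
... | true  = ofⁿ (compDesFrom-head (suc acc) i I ∘ ≡.sym)
... | false = sat-reflects (suc acc) i I (b ∷ w) I≥1 (ℕ.suc-injective e)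
sat-reflects acc (suc i) I (a ∷ []) _ ()
sat-reflects acc zero (suc j ∷ I) (a ∷ []) _ ()
sat-reflects acc zero (zero ∷ I) _ (() ∷ _)

-- Decoding Lehmer codes.

data Pick : ℕ → ℕ → List ℕ → List ℕ → Set where
  here  : ∀ {v L} → Pick 0 v (v ∷ L) L
  there : ∀ {a v y L L′} → Pick a v L L′ → Pick (suc a) v (y ∷ L) (y ∷ L′)

delete : ℕ → List ℕ → List ℕ
delete a       []      = []
delete zero    (y ∷ L) = L
delete (suc a) (y ∷ L) = y ∷ delete a L

decode : List ℕ → List ℕ → List ℕ
decode L []      = []
decode L (a ∷ c) = lookupℕ L a ∷ decode (delete a L) c

pick : ∀ {a} L → a < length L → Pick a (lookupℕ L a) L (delete a L)
pick {zero}  (y ∷ L) _        = here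
pick {suc a} (y ∷ L) (s≤s a<) = there (pick L a<)

pick-length : ∀ {a v L L′} → Pick a v L L′ → length L ≡ suc (length L′)
pick-length here      = refl
pick-length (there p) = ≡.cong suc (pick-length p)

pick-⊆ : ∀ {a v L L′} → Pick a v L L′ → L′ ⊆ L
pick-⊆ (here {v}) = v skip ⊆-refl
pick-⊆ (there p)  = refl ∷ pick-⊆ p

pick-All⁻ : ∀ {P : ℕ → Set} {a v L L′} → Pick a v L L′ → All P L → P v × All P L′
pick-All⁻ here      (q ∷ qs) = q , qs
pick-All⁻ (there p) (q ∷ qs) = Product.map₂ (q ∷_) (pick-All⁻ p qs)

pick-All⁺ : ∀ {P : ℕ → Set} {a v L L′} → Pick a v L L′ → P v → All P L′ → All P L
pick-All⁺ here      q qs        = q ∷ qs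
pick-All⁺ (there p) q (q′ ∷ qs) = q′ ∷ pick-All⁺ p q qs

Sorted : List ℕ → Set
Sorted = AllPairs _<_

pick-Sorted : ∀ {a v L L′} → Pick a v L L′ → Sorted L → Sorted L′
pick-Sorted here      (_  ∷ s) = s
pick-Sorted (there p) (qs ∷ s) = proj₂ (pick-All⁻ p qs) ∷ pick-Sorted p s

pick-distinct : ∀ {a v L L′} → Pick a v L L′ → Sorted L → All (v ≢_) L′
pick-distinct here      (v< ∷ _) = All.map ℕ.<⇒≢ v<
pick-distinct (there p) (y< ∷ s) = (ℕ.>⇒≢ (proj₁ (pick-All⁻ p y<))) ∷ pick-distinct p s

delete-length : ∀ {a m} L → a < length L → length L ≡ suc m → length (delete a L) ≡ m
delete-length L a< e = ℕ.suc-injective (≡.trans (≡.sym (pick-length (pick L a<))) e)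

All-lookupℕ : ∀ {P : ℕ → Set} {L b} → All P L → b < length L → P (lookupℕ L b)
All-lookupℕ {L = L} ps b< = proj₁ (pick-All⁻ (pick L b<) ps)

-- Positions below `a` still hold smaller values, while position `a` now holds the next larger one;
-- hence equal code letters give an ascent.
lookup-delete-<ᵇ : ∀ a b L → Sorted L → a < length L → b < length (delete a L) →
  (lookupℕ (delete a L) b <ᵇ lookupℕ L a) ≡ (b <ᵇ a)
lookup-delete-<ᵇ zero    b       (y ∷ L) (y< ∷ _) _ b< = <ᵇ-false (ℕ.<⇒≤ (All-lookupℕ y< b<))
lookup-delete-<ᵇ (suc a) zero    (y ∷ L) (y< ∷ _) (s≤s a<) _ = <ᵇ-true (All-lookupℕ y< a<)
lookup-delete-<ᵇ (suc a) (suc b) (y ∷ L) (_ ∷ s)  (s≤s a<) (s≤s b<) = lookup-delete-<ᵇ a b L s a< b<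

descFrom-decode : ∀ j {m c} L → Code m c → length L ≡ m → Sorted L →
                  descFrom j (decode L c) ≡ descFrom j c
descFrom-decode j L []             e s = refl
descFrom-decode j L (_ ∷ [])       e s = refl
descFrom-decode j {c = a ∷ b ∷ c} L (a≤ ∷ C@(b≤ ∷ _)) e s = ≡.cong₂ (λ t l → if t then j ∷ l else l)
  (lookup-delete-<ᵇ a b L s a< (≡.subst (b <_) (≡.sym e′) (s≤s b≤)))
  (descFrom-decode (suc j) (delete a L) C e′ (pick-Sorted (pick L a<) s))
  where
  a< = ≡.subst (a <_) (≡.sym e) (s≤s a≤)
  e′ = delete-length L a< e

-- Prepending `v` gives it position 1 and raises all other positions by one; the 1 appears at the
-- place `a` of `v` in `L`.
map-posOf-pick : ∀ {a v L L′} u → Pick a v L L′ → All (v ≢_) L′ →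
  map (λ t → posOf t (v ∷ u)) L ≡ ins a 1 (map suc (map (λ t → posOf t u) L′))
map-posOf-pick {v = v} u here v≢ rewrite ≡ᵇ-refl v = ≡.cong (1 ∷_) (rest v≢)
  where
  rest : ∀ {L} → All (v ≢_) L → map (λ t → posOf t (v ∷ u)) L ≡ map suc (map (λ t → posOf t u) L)
  rest []        = refl
  rest (ne ∷ v≢) rewrite ≡ᵇ-false ne = ≡.cong (_ ∷_) (rest v≢)
map-posOf-pick u (there p) (ne ∷ v≢) rewrite ≡ᵇ-false ne = ≡.cong (_ ∷_) (map-posOf-pick u p v≢)

-- For `L = range1 n` the left side is `inverse n`; a general sorted `L` stands for the values left
-- after deletions.
map-posOf-decode : ∀ {m c} L → Code m c → length L ≡ m → Sorted L →
                   map (λ v → posOf v (decode L c)) L ≡ inverseWord c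
map-posOf-decode []      []       e s = refl
map-posOf-decode {c = a ∷ c} L (a≤ ∷ C) e s = ≡.trans
  (map-posOf-pick (decode (delete a L) c) p (pick-distinct p s))
  (≡.cong (ins a 1 ∘ map suc) (map-posOf-decode (delete a L) C (delete-length L a< e) (pick-Sorted p s)))
  where
  a< = ≡.subst (a <_) (≡.sym e) (s≤s a≤)
  p  = pick L a<

-- Subwords of the inverse word; `Ic` and `Mc` as sequences of labels.

filterᵇ-∷ : ∀ {A : Set} (p : A → Bool) y w → filterᵇ p (y ∷ w) ≡ (if p y then y ∷ filterᵇ p w else filterᵇ p w)
filterᵇ-∷ p y w with p y
... | true  = refl
... | false = refl

sub-∷ : ∀ i y w → sub i (y ∷ w) ≡ (if i ≤ᵇ y then y ∷ sub i w else sub i w)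
sub-∷ i = filterᵇ-∷ (i ≤ᵇ_)

sub-suc : ∀ k w → sub (suc (suc k)) w ≡ sub (suc (suc k)) (sub (suc k) w)
sub-suc k []      = refl
sub-suc k (y ∷ w) rewrite sub-∷ (suc (suc k)) y w | sub-∷ (suc k) y w
  with k <ᵇ y in e
... | true rewrite sub-∷ (suc (suc k)) y (sub (suc k) w) | sub-suc k w = refl
... | false rewrite <ᵇ-false (ℕ.m≤n⇒m≤1+n (<ᵇ-false⁻ k y e)) = sub-suc k w

sub-shifted : ∀ k {w} → All (1 ≤_) w → sub (suc (suc k)) (map (k +_) (map suc w)) ≡ map (suc k +_) w
sub-shifted k []                    = refl
sub-shifted k {t ∷ w} (t≥1 ∷ w≥1)
  rewrite sub-∷ (suc (suc k)) (k + suc t) (map (k +_) (map suc w)) | ℕ.+-suc k t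
        | <ᵇ-true (ℕ.m<m+n k t≥1) = ≡.cong (_ ∷_) (sub-shifted k w≥1)

-- Shifted by `k`, the inserted 1 becomes `k + 1`, the only letter below the threshold `k + 2`.
sub-ins : ∀ k a {w} → All (1 ≤_) w →
          sub (suc (suc k)) (map (k +_) (ins a 1 (map suc w))) ≡ map (suc k +_) w
sub-ins k zero {w} w≥1
  rewrite sub-∷ (suc (suc k)) (k + 1) (map (k +_) (map suc w)) | ℕ.+-comm k 1
        | <ᵇ-false (ℕ.≤-refl {k}) = sub-shifted k w≥1
sub-ins k (suc a) []
  rewrite sub-∷ (suc (suc k)) (k + 1) [] | ℕ.+-comm k 1 | <ᵇ-false (ℕ.≤-refl {k}) = refl
sub-ins k (suc a) {t ∷ w} (t≥1 ∷ w≥1)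
  rewrite sub-∷ (suc (suc k)) (k + suc t) (map (k +_) (ins a 1 (map suc w))) | ℕ.+-suc k t
        | <ᵇ-true (ℕ.m<m+n k t≥1) = ≡.cong (_ ∷_) (sub-ins k a w≥1)

sub-1 : ∀ {w} → All (1 ≤_) w → sub 1 w ≡ w
sub-1 []             = refl
sub-1 (s≤s _ ∷ w≥1) = ≡.cong (_ ∷_) (sub-1 w≥1)

-- Before the first `suc k`, a letter that is at least `suc k` is greater. The count in `Ic` thus
-- becomes a length inside `sub (suc k) w`, whose form is known for inverse words.
filter-before : ∀ k w → filterᵇ (suc k <ᵇ_) (before (suc k) w) ≡ before (suc k) (sub (suc k) w)
filter-before k []      = refl
filter-before k (y ∷ w) rewrite sub-∷ (suc k) y w with ℕ.<-cmp y (suc k)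
... | tri≈ _ refl _ rewrite ≡ᵇ-refl k | <ᵇ-true (ℕ.n<1+n k) | ≡ᵇ-refl k = refl
... | tri< (s≤s y≤k) y≢ _
  rewrite ≡ᵇ-false y≢ | <ᵇ-false y≤k
        | filterᵇ-∷ (suc k <ᵇ_) y (before (suc k) w) | <ᵇ-false (ℕ.m≤n⇒m≤1+n y≤k) = filter-before k w
... | tri> _ y≢ y>
  rewrite ≡ᵇ-false y≢ | <ᵇ-true (ℕ.<⇒≤ y>)
        | filterᵇ-∷ (suc k <ᵇ_) y (before (suc k) w) | <ᵇ-true y> | ≡ᵇ-false y≢ =
  ≡.cong (y ∷_) (filter-before k w)

length-before-ins : ∀ k a {w} → All (1 ≤_) w → a ≤ length w →
  length (before (suc k) (map (k +_) (ins a 1 (map suc w)))) ≡ a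
length-before-ins k zero _ _ rewrite ℕ.+-comm k 1 | ≡ᵇ-refl k = refl
length-before-ins k (suc a) {t ∷ w} (t≥1 ∷ w≥1) (s≤s a≤)
  rewrite ℕ.+-suc k t | ≡ᵇ-false (ℕ.>⇒≢ (ℕ.m<m+n k t≥1)) = ≡.cong suc (length-before-ins k a w≥1 a≤)

-- `sub (suc k) τ` is, up to the shift by k, the inverse word of the code with
-- its first k letters removed.
map-labels : ∀ (Λ : Labelling) τ n (F : ℕ → ℕ) →
  (∀ k {m a c} → Code (suc m) (a ∷ c) → k + suc m ≡ n →
     sub (suc k) τ ≡ map (k +_) (inverseWord (a ∷ c)) →
     sub (suc (suc k)) τ ≡ map (suc k +_) (inverseWord c) → F (suc k) ≡ Labelling.lab Λ a c) →
  ∀ k f {m c} → (∀ t → f t ≡ k + t) → Code m c → k + m ≡ n →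
  sub (suc k) τ ≡ map (k +_) (inverseWord c) →
  map F (map suc (applyUpTo f m)) ≡ Labelling.labels Λ c
map-labels Λ τ n F hyp k f f≡ []                           e s = refl
map-labels Λ τ n F hyp k f {suc m} {a ∷ c} f≡ C@(_ ∷ C′) e s = ≡.cong₂ _∷_
  (≡.trans (≡.cong (F ∘ suc) (≡.trans (f≡ 0) (ℕ.+-identityʳ k))) (hyp k C e s s′))
  (map-labels Λ τ n F hyp (suc k) (f ∘ suc) (λ t → ≡.trans (f≡ (suc t)) (ℕ.+-suc k t)) C′
    (≡.trans (≡.sym (ℕ.+-suc k m)) e) s′)
  where
  s′ = ≡.trans (sub-suc k τ) (≡.trans (≡.cong (sub (suc (suc k))) s) (sub-ins k a (inverseWord-positive c)))

sub-1-inverseWord : ∀ c → sub 1 (inverseWord c) ≡ map (0 +_) (inverseWord c)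
sub-1-inverseWord c = ≡.trans (sub-1 (inverseWord-positive c)) (≡.sym (List.map-id (inverseWord c)))

Ic-inverseWord : ∀ {n c} → Code n c → Ic n (inverseWord c) ≡ Labelling.labels invLabelling c
Ic-inverseWord {n} {c₀} C₀ = map-labels invLabelling τ n _ head 0 id (λ _ → refl) C₀ refl (sub-1-inverseWord c₀)
  where
  τ = inverseWord c₀
  head : ∀ k {m a c} → Code (suc m) (a ∷ c) → k + suc m ≡ n →
    sub (suc k) τ ≡ map (k +_) (inverseWord (a ∷ c)) → _ →
    length (filterᵇ (suc k <ᵇ_) (before (suc k) τ)) ≡ a
  head k {a = a} {c} (a≤ ∷ C) _ s _ = ≡.trans (≡.cong length (filter-before k τ))
    (≡.trans (≡.cong (length ∘ before (suc k)) s)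
      (length-before-ins k a (inverseWord-positive c) (≡.subst (a ≤_) (≡.sym (length-inverseWord C)) a≤)))

Mc-inverseWord : ∀ {n c} → Code n c → Mc n (inverseWord c) ≡ Labelling.labels majLabelling c
Mc-inverseWord {n} {c₀} C₀ = map-labels majLabelling τ n _ head 0 id (λ _ → refl) C₀ refl (sub-1-inverseWord c₀)
  where
  τ = inverseWord c₀
  head : ∀ k {m a c} → Code (suc m) (a ∷ c) → k + suc m ≡ n →
    sub (suc k) τ ≡ map (k +_) (inverseWord (a ∷ c)) →
    sub (suc (suc k)) τ ≡ map (suc k +_) (inverseWord c) →
    (if suc k ≡ᵇ n then 0 else maj (sub (suc k) τ) ∸ maj (sub (suc (suc k)) τ)) ≡ majLab a c
  -- Here `suc k` is `n`: the entry 0 prescribed by `Mc` agrees with the label of the only gap of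
  -- the empty word.
  head k {zero} (z≤n ∷ []) refl _ _ rewrite ℕ.+-comm k 1 | ≡ᵇ-refl k = refl
  head k {suc m} {a} {c} _ refl s s′
    rewrite ℕ.+-suc k (suc m) | ≡ᵇ-false (ℕ.<⇒≢ (ℕ.m<m+n k (s≤s (z≤n {m})))) = ≡.trans
    (≡.cong₂ (λ u v → maj u ∸ maj v) s s′)
    (≡.cong₂ _∸_ (maj-shift k (inverseWord (a ∷ c))) (maj-shift (suc k) (inverseWord c)))

-- Words containing each of the given values once.

eachOnce : List ℕ → List ℕ → Bool
eachOnce L w = and (map (λ v → count v w ≡ᵇ 1) L)

eachOnce⁻ : ∀ L w → eachOnce L w ≡ true → All (λ v → count v w ≡ 1) L
eachOnce⁻ []      w _ = []
eachOnce⁻ (v ∷ L) w e with count v w ≡ᵇ 1 in e₁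
... | true = ≡ᵇ-true⁻ (count v w) 1 e₁ ∷ eachOnce⁻ L w e

eachOnce⁺ : ∀ {L} w → All (λ v → count v w ≡ 1) L → eachOnce L w ≡ true
eachOnce⁺ w []       = refl
eachOnce⁺ w (e ∷ es) rewrite e = eachOnce⁺ w es

count-∷-≡ : ∀ v w → count v (v ∷ w) ≡ suc (count v w)
count-∷-≡ v w rewrite filterᵇ-∷ (_≡ᵇ v) v w | ≡ᵇ-refl v = refl

count-∷-≢ : ∀ {u v} w → u ≢ v → count v (u ∷ w) ≡ count v w
count-∷-≢ {u} {v} w u≢v rewrite filterᵇ-∷ (_≡ᵇ v) u w | ≡ᵇ-false u≢v = refl

count-pick : ∀ {a u v w w′} → Pick a u w w′ → u ≢ v → count v w ≡ count v w′
count-pick here u≢v = count-∷-≢ _ u≢v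
count-pick {v = v} (there {y = y} {L = w} {L′ = w′} p) u≢v
  rewrite filterᵇ-∷ (_≡ᵇ v) y w | filterᵇ-∷ (_≡ᵇ v) y w′ with y ≡ᵇ v
... | true  = ≡.cong suc (count-pick p u≢v)
... | false = count-pick p u≢v

count⇒pick : ∀ v w → 1 ≤ count v w → ∃₂ λ a w′ → Pick a v w w′
count⇒pick v (y ∷ w) 1≤ with y ℕ.≟ v
... | yes refl = 0 , w , here
... | no  y≢v  with count⇒pick v w (≡.subst (1 ≤_) (count-∷-≢ w y≢v) 1≤)
...   | a , w′ , p = suc a , y ∷ w′ , there p

-- Each value of `L` uses up one letter of `w`, which leaves the counts of the other values intact.
pigeonhole : ∀ {L} w → AllPairs _≢_ L → All (λ v → 1 ≤ count v w) L → length L ≤ length w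
pigeonhole         w []        []         = z≤n
pigeonhole {v ∷ L} w (v≢ ∷ ne) (1≤ ∷ 1≤s) with count⇒pick v w 1≤
... | a , w′ , p rewrite pick-length p = s≤s (pigeonhole w′ ne
  (All.zipWith (λ (v≢u , 1≤u) → ≡.subst (1 ≤_) (count-pick p v≢u) 1≤u) (v≢ , 1≤s)))

Sorted⇒distinct : ∀ {L} → Sorted L → AllPairs _≢_ L
Sorted⇒distinct = AllPairs.map ℕ.<⇒≢

1≤1 : ∀ {n} → n ≡ 1 → 1 ≤ n
1≤1 refl = s≤s z≤n

-- As `v` meets none of the demands, `w` alone would have to contain all of `L`, one value more than
-- it has letters.
eachOnce-∉ : ∀ {L v} w → Sorted L → length L ≡ suc (length w) → All (v ≢_) L →
             eachOnce L (v ∷ w) ≡ false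
eachOnce-∉ {L} {v} w s e v∉L with eachOnce L (v ∷ w) in eq
... | false = refl
... | true  = ⊥-elim (ℕ.1+n≰n (≡.subst (_≤ length w) e (pigeonhole w (Sorted⇒distinct s)
  (All.zipWith (λ (v≢u , c≡1) → 1≤1 (≡.trans (≡.sym (count-∷-≢ w v≢u)) c≡1)) (v∉L , eachOnce⁻ L (v ∷ w) eq)))))

eachOnce-pick : ∀ {a v L L′} w → Pick a v L L′ → Sorted L → length L ≡ suc (length w) →
                eachOnce L (v ∷ w) ≡ eachOnce L′ w
eachOnce-pick {a} {v} {L} {L′} w p s e = Bool.⇔→≡ {z = true} (mk⇔ to from)
  where
  v∉ : All (v ≢_) L′
  v∉ = pick-distinct p s
  to : eachOnce L (v ∷ w) ≡ true → eachOnce L′ w ≡ true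
  to eq = eachOnce⁺ w (All.zipWith (λ (v≢u , c≡1) → ≡.trans (≡.sym (count-∷-≢ w v≢u)) c≡1)
    (v∉ , proj₂ (pick-All⁻ p (eachOnce⁻ L (v ∷ w) eq))))
  from : eachOnce L′ w ≡ true → eachOnce L (v ∷ w) ≡ true
  from eq = eachOnce⁺ (v ∷ w) (pick-All⁺ p (≡.trans (count-∷-≡ v w) (≡.cong suc absent))
    (All.zipWith (λ (v≢u , c≡1) → ≡.trans (count-∷-≢ w v≢u) c≡1) (v∉ , once)))
    where
    once : All (λ u → count u w ≡ 1) L′
    once = eachOnce⁻ L′ w eq
    absent : count v w ≡ 0
    absent with count v w in eq₁
    ... | zero  = refl
    -- A second `v` would put the distinct values `v ∷ L′` into `w`, one more than its length.
    ... | suc _ = ⊥-elim (ℕ.1+n≰n (≡.subst (_≤ length w) (≡.trans (≡.sym (pick-length p)) e)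
      (pigeonhole w (v∉ ∷ Sorted⇒distinct (pick-Sorted p s))
        (≡.subst (1 ≤_) (≡.sym eq₁) (s≤s z≤n) ∷ All.map 1≤1 once))))

range1-Sorted : ∀ n → Sorted (range1 n)
range1-Sorted n = AllPairs.map⁺ (AllPairs.applyUpTo⁺₁ id n (λ i<j _ → s≤s i<j))

length-range1 : ∀ n → length (range1 n) ≡ n
length-range1 n = ≡.trans (List.length-map suc (upTo n)) (List.length-upTo n)

allWords-length : ∀ n k → All (λ w → length w ≡ k) (allWords n k)
allWords-length n zero    = refl ∷ []
allWords-length n (suc k) = All.concat⁺ (All.map⁺ (All.universal
  (λ v → All.map⁺ (All.map (≡.cong suc) (allWords-length n k))) (range1 n)))

⌊⌋-reflects : ∀ {A : Set} {b} (d : Dec A) → Reflects A b → ⌊ d ⌋ ≡ b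
⌊⌋-reflects (true  because _)      (ofʸ _)  = refl
⌊⌋-reflects (true  because ofʸ a)  (ofⁿ ¬a) = ⊥-elim (¬a a)
⌊⌋-reflects (false because ofⁿ ¬a) (ofʸ a)  = ⊥-elim (¬a a)
⌊⌋-reflects (false because _)      (ofⁿ _)  = refl

-- Sums over permutations as sums over codes.

module Permutations {c ℓ : Level} (R : CommutativeRing c ℓ) where
  open CommutativeRing R hiding (zero; refl) renaming (_+_ to _+R_)
  open CommutativeRing R using () renaming (refl to ≈-refl)
  open WithRing R
  open Summation R
  open import Relation.Binary.Reasoning.Setoid setoid

  sumOver : ∀ {A : Set} → List A → (A → Carrier) → Carrier
  sumOver xs f = sumR (map f xs)

  sumOver-cong : ∀ {A : Set} {xs : List A} {f g} → All (λ y → f y ≈ g y) xs → sumOver xs f ≈ sumOver xs g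
  sumOver-cong []       = ≈-refl
  sumOver-cong (e ∷ es) = +-cong e (sumOver-cong es)

  sumOver-0 : ∀ {A : Set} (xs : List A) → sumOver xs (λ _ → 0#) ≈ 0#
  sumOver-0 []       = ≈-refl
  sumOver-0 (_ ∷ xs) = trans (+-identityˡ _) (sumOver-0 xs)

  sumOver-++ : ∀ {A : Set} (xs ys : List A) f → sumOver (xs ++ ys) f ≈ sumOver xs f +R sumOver ys f
  sumOver-++ []       ys f = sym (+-identityˡ _)
  sumOver-++ (y ∷ xs) ys f = trans (+-congˡ (sumOver-++ xs ys f)) (sym (+-assoc _ _ _))

  sumOver-filter : ∀ {A : Set} (p : A → Bool) xs f →
    sumOver (filterᵇ p xs) f ≈ sumOver xs (λ y → if p y then f y else 0#)
  sumOver-filter p []       f = ≈-refl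
  sumOver-filter p (y ∷ xs) f rewrite filterᵇ-∷ p y xs with p y
  ... | true  = +-congˡ (sumOver-filter p xs f)
  ... | false = trans (sumOver-filter p xs f) (sym (+-identityˡ _))

  sumOver-prepend : ∀ (vs : List ℕ) (ws : List (List ℕ)) f →
    sumOver (concatMap (λ v → map (v ∷_) ws) vs) f ≈ sumOver vs (λ v → sumOver ws (f ∘ (v ∷_)))
  sumOver-prepend []       ws f = ≈-refl
  sumOver-prepend (v ∷ vs) ws f = trans (sumOver-++ (map (v ∷_) ws) _ f)
    (+-cong (reflexive (≡.cong sumR (≡.sym (List.map-∘ ws)))) (sumOver-prepend vs ws f))

  sumOver-⊆ : ∀ {L N} {g : ℕ → Carrier} → L ⊆ N → Sorted N →
    All (λ v → All (v ≢_) L → g v ≈ 0#) N → sumOver N g ≈ sumOver L g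
  sumOver-⊆ []            _         _        = ≈-refl
  sumOver-⊆ (y skip sub)   (y< ∷ s)  (z ∷ zs) =
    trans (+-cong (z (All.map ℕ.<⇒≢ (All-resp-⊆ sub y<))) (sumOver-⊆ sub s zs)) (+-identityˡ _)
  sumOver-⊆ (refl ∷ sub)  (y< ∷ s)  (_ ∷ zs) = +-congˡ (sumOver-⊆ sub s
    (All.zipWith (λ (y<v , z) v∉ → z (ℕ.>⇒≢ y<v ∷ v∉)) (y< , zs)))

  sumTo-front : ∀ n g → sumTo (suc n) g ≈ g 0 +R sumTo n (g ∘ suc)
  sumTo-front zero    g = +-comm _ _
  sumTo-front (suc n) g = trans (+-congʳ (sumTo-front n g)) (+-assoc _ _ _)

  sumOver-lookup : ∀ L g → sumOver L g ≈ sumTo (length L) (g ∘ lookupℕ L)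
  sumOver-lookup []      g = ≈-refl
  sumOver-lookup (v ∷ L) g = trans (+-congˡ (sumOver-lookup L g)) (sym (sumTo-front (length L) _))

  sumCodes-0 : ∀ m → sumCodes m (λ _ → 0#) ≈ 0#
  sumCodes-0 zero    = ≈-refl
  sumCodes-0 (suc m) = trans (sumCodes-cong m (λ _ _ → zeros (suc m))) (sumCodes-0 m)
    where
    zeros : ∀ n → sumTo n (λ _ → 0#) ≈ 0#
    zeros zero    = ≈-refl
    zeros (suc n) = trans (+-identityʳ _) (zeros n)

  sumTo-sumCodes : ∀ n m (f : ℕ → List ℕ → Carrier) →
    sumTo n (λ a → sumCodes m (f a)) ≈ sumCodes m (λ c → sumTo n (λ a → f a c))
  sumTo-sumCodes zero    m f = sym (sumCodes-0 m)
  sumTo-sumCodes (suc n) m f =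
    trans (+-congʳ (sumTo-sumCodes n m f)) (sym (sumCodes-+ m (λ c → sumTo n (λ a → f a c)) (f n)))

  -- `L` holds the values still to be placed and shrinks, while the alphabet of `allWords` stays
  -- `range1 n`. A first letter outside `L` contributes nothing; otherwise its position in `L` is
  -- the first code letter.
  sumWords : ∀ n k L → length L ≡ k → L ⊆ range1 n → Sorted L → ∀ f →
    sumOver (allWords n k) (λ w → if eachOnce L w then f w else 0#) ≈ sumCodes k (f ∘ decode L)
  sumWords n zero    []  e L⊆ s f = +-identityʳ _
  sumWords n (suc k) L e L⊆ s f = begin
    sumOver (allWords n (suc k)) (λ w → if eachOnce L w then f w else 0#)
      ≈⟨ sumOver-prepend (range1 n) (allWords n k) _ ⟩
    sumOver (range1 n) g
      ≈⟨ sumOver-⊆ L⊆ (range1-Sorted n) (All.universal vanish (range1 n)) ⟩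
    sumOver L g
      ≈⟨ sumOver-lookup L g ⟩
    sumTo (length L) (g ∘ lookupℕ L)
      ≡⟨ ≡.cong (λ m → sumTo m (g ∘ lookupℕ L)) e ⟩
    sumTo (suc k) (g ∘ lookupℕ L)
      ≈⟨ sumTo-cong (suc k) (λ a a< → recurse a (≡.subst (a <_) (≡.sym e) a<)) ⟩
    sumTo (suc k) (λ a → sumCodes k (λ c → f (decode L (a ∷ c))))
      -- Words are summed with the first letter outermost, codes with it innermost.
      ≈⟨ sumTo-sumCodes (suc k) k (λ a c → f (decode L (a ∷ c))) ⟩
    sumCodes (suc k) (f ∘ decode L) ∎
    where
    g : ℕ → Carrier
    g v = sumOver (allWords n k) (λ w → if eachOnce L (v ∷ w) then f (v ∷ w) else 0#)
    len : ∀ (w : List ℕ) → length w ≡ k → length L ≡ suc (length w)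
    len w refl = e
    vanish : ∀ v → All (v ≢_) L → g v ≈ 0#
    vanish v v∉ = trans
      (sumOver-cong (All.map (λ {w} lw → reflexive
        (≡.cong (if_then f (v ∷ w) else 0#) (eachOnce-∉ w s (len w lw) v∉))) (allWords-length n k)))
      (sumOver-0 (allWords n k))
    recurse : ∀ a → a < length L → g (lookupℕ L a) ≈ sumCodes k (λ c → f (decode L (a ∷ c)))
    recurse a a< = trans
      (sumOver-cong (All.map (λ {w} lw → reflexive
        (≡.cong (if_then f (lookupℕ L a ∷ w) else 0#) (eachOnce-pick w p s (len w lw)))) (allWords-length n k)))
      (sumWords n k (delete a L) (delete-length L a< e) (⊆-trans (pick-⊆ p) L⊆) (pick-Sorted p s)
        (f ∘ (lookupℕ L a ∷_)))
      where
      p = pick L a<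

  sumOver-Sym : ∀ n f → sumOver (Sym n) f ≈ sumCodes n (f ∘ decode (range1 n))
  sumOver-Sym n f = trans (sumOver-filter (isPermᵇ n) (allWords n n) f)
    (sumWords n n (range1 n) (length-range1 n) ⊆-refl (range1-Sorted n) f)

  -- Treats both statistics at once: all that is asked of `stat` is that it lists the labels of some
  -- labelling on inverse words.
  sumOver-DI : ∀ x (Λ : Labelling) (stat : ℕ → List ℕ → List ℕ) →
    (∀ {n c} → Code n c → stat n (inverseWord c) ≡ Labelling.labels Λ c) →
    ∀ n I → 1 ≤ n → IsComposition n I →
    sumOver (DI n I) (λ σ → monomial x (stat n (inverse n σ))) ≈ ribbon x n I
  sumOver-DI x Λ stat stat≡ .(sumℕ [])    []       ()  ([] , refl)
  sumOver-DI x Λ stat stat≡ _ (suc i ∷ I) _ (_ ∷ I≥1 , refl) = begin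
    sumOver (DI n (suc i ∷ I)) f
      ≈⟨ sumOver-filter _ (Sym n) f ⟩
    sumOver (Sym n) (λ σ → if hasDescents σ then f σ else 0#)
      ≈⟨ sumOver-Sym n _ ⟩
    sumCodes n (λ c → if hasDescents (decode (range1 n) c) then f (decode (range1 n) c) else 0#)
      ≈⟨ sumCodes-cong n (λ c C → reflexive (≡.cong₂ orZero (test C) (value C))) ⟩
    satSum x Λ n (constraints (suc i ∷ I))
      ≈⟨ satSum≈ribbon x Λ i I I≥1 ⟩
    ribbon x n (suc i ∷ I) ∎
    where
    n = suc i + sumℕ I
    f : List ℕ → Carrier
    f σ = monomial x (stat n (inverse n σ))
    orZero : Bool → Carrier → Carrier
    orZero b a = if b then a else 0#
    hasDescents : List ℕ → Bool
    hasDescents σ = ⌊ List.≡-dec ℕ._≟_ (descents σ) (compDes (suc i ∷ I)) ⌋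
    test : ∀ {c} → Code n c → hasDescents (decode (range1 n) c) ≡ sat (constraints (suc i ∷ I)) c
    test {c} C = ≡.trans
      (≡.cong (λ d → ⌊ List.≡-dec ℕ._≟_ d (compDes (suc i ∷ I)) ⌋)
        (descFrom-decode 1 (range1 n) C (length-range1 n) (range1-Sorted n)))
      (⌊⌋-reflects _ (sat-reflects 0 i I c I≥1 (Code-length C)))
    value : ∀ {c} → Code n c → f (decode (range1 n) c) ≡ weight x Λ c
    value C = ≡.cong (monomial x) (≡.trans
      (≡.cong (stat n) (map-posOf-decode (range1 n) C (length-range1 n) (range1-Sorted n)))
      (stat≡ C))

mainTheorem1 : {c ℓ : Level} (R : CommutativeRing c ℓ) (x : ℕ → CommutativeRing.Carrier R)
    (n : ℕ) (I : List ℕ) → 1 ≤ n → IsComposition n I →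
    CommutativeRing._≈_ R
    (WithRing.sumR R (map (λ σ → WithRing.monomial R x (Mc n (inverse n σ))) (DI n I)))
    (WithRing.sumR R (map (λ σ → WithRing.monomial R x (Ic n (inverse n σ))) (DI n I)))
    × CommutativeRing._≈_ R
    (WithRing.sumR R (map (λ σ → WithRing.monomial R x (Ic n (inverse n σ))) (DI n I)))
    (WithRing.ribbon R x n I)
mainTheorem1 R x n I n≥1 comp = trans Mc-sum (sym Ic-sum) , Ic-sum
  where
  open CommutativeRing R using (trans; sym)
  open Permutations R using (sumOver-DI)
  Mc-sum = sumOver-DI x majLabelling Mc Mc-inverseWord n I n≥1 comp
  Ic-sum = sumOver-DI x invLabelling Ic Ic-inverseWord n I n≥1 comp
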